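{- Let $G$ be a road network with vertex set $V=V(G)$ and let $H_G=(\mathcal{N},\mathcal{E},\ell)$ be a balanced tree hierarchy of $G$. For $v\in V$ let $A_v=\{u\in V(G)\mid u\preceq v\}$, where $\preceq$ is the vertex quasi-order defined by $H_G$. Then the space complexity of the naive labelling of $G$ with respect to $H_G$ is bounded by $O\big(\sum_{v\in V}|A_v|\big)$.
   Context: A road network is a finite undirected graph $G=(V,E)$ in which each edge has a positive real weight; $d_G(s,t)$ is the minimum total weight of a path between $s$ and $t$. For $0<\beta\le 0.5$, a balanced tree hierarchy of $G$ is a rooted binary tree $H_G=(\mathcal{N},\mathcal{E},\ell)$ with node set $\mathcal{N}$, edge set $\mathcal{E}$ and a total surjective function $\ell:V(G)\to\mathcal{N}$ such that: (1) for every internal tree node $N_i$, $|\mathrm{Left}(N_i)|,|\mathrm{Right}(N_i)|\le(1-\beta)\cdot|\mathrm{Subtree}(N_i)|$, where $\mathrm{Left}(N_i)$, $\mathrm{Right}(N_i)$ are the sets of vertices mapped by $\ell$ into the left and right subtrees of $N_i$, and $\mathrm{Subtree}(N_i)$ is the set of vertices mapped into the whole subtree rooted at $N_i$ (including $N_i$); (2) for any $s,t\in V(G)$, the lowest common ancestor of $\ell(s)$ and $\ell(t)$ contains at least one vertex on a shortest path between $s$ and $t$. A tree node $N_i$ is said to contain $u$ (written $u\in N_i$) if $\ell(u)=N_i$. The vertex quasi-order $\preceq$ on $V(G)$ is defined by $v_i\preceq v_j$ iff $\ell(v_i)$ is an ancestor of $\ell(v_j)$ in $H_G$, where a node counts as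 an ancestor of itself. The naive labelling is constructed as follows: start with $L(v)=\emptyset$ for all $v\in V(G)$; for each tree node $N_i\in\mathcal{N}$ and each $u\in N_i$, compute the distances from $u$ and add the distance entry $(u,d_G(u,v))$ to $L(v)$ for every $v\in\mathrm{Subtree}(N_i)$. Space is measured in the total number of stored distance entries, each taking constant space. -}

module Defs where

open import Algebra.Bundles using (CommutativeMonoid)
open import Data.Empty using (⊥)
open import Data.Fin.Base using (Fin)
open import Data.Fin.Properties using () renaming (_≟_ to _≟F_)
open import Data.List.Base
  using (List; []; _∷_; _++_; map; foldr; filter; length; head; last;
         concatMap; cartesianProductWith; upTo; allFin)
open import Data.List.Membership.Propositional using (_∈_)
open import Data.List.Relation.Unary.Linked using (Linked; linked?)
open import Data.List.Relation.Unary.Unique.Propositional using (Unique)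
open import Data.Maybe using (Maybe; just; nothing; Is-just)
open import Data.Maybe.Properties using (≡-dec)
open import Data.Maybe.Relation.Unary.Any using (just)
open import Data.Nat.Base as ℕ using (ℕ; zero; suc)
open import Data.Nat.ListAction using (sum)
import Data.Nat.Properties as ℕₚ
open import Data.Product.Base using (∃-syntax; _×_; _,_)
open import Data.Rational.Base as ℚ using (ℚ; 0ℚ; 1ℚ; ½)
import Data.Rational.Properties as ℚₚ
open import Data.Unit.Base using (⊤; tt)
import Data.Vec.Functional as Vector
open import Function.Base using (const)
open import Function.Definitions using (Surjective)
open import Relation.Binary.Definitions using (DecidableEquality; Decidable)
open import Relation.Binary.PropositionalEquality
  using (_≡_; refl; sym; trans; cong; subst)
open import Relation.Nullary using (¬_; Dec; yes; no)
open import Relation.Nullary.Decidable using (_×-dec_; map′)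
open import Algebra.Properties.CommutativeSemigroup
  (CommutativeMonoid.commutativeSemigroup ℚₚ.+-0-commutativeMonoid)
  using (interchange)
import Data.List.Relation.Unary.Unique.DecPropositional as UniqueDec

------------------------------------------------------------------------
-- Real numbers, as Cauchy sequences of rationals

-- Since m and n range symmetrically, the bound says ∣ x m - x n ∣ ≤ ε.
IsCauchy : (ℕ → ℚ) → Set
IsCauchy x = ∀ ε → 0ℚ ℚ.< ε →
  ∃[ N ] ∀ m n → N ℕ.≤ m → N ℕ.≤ n → x m ℚ.≤ x n ℚ.+ ε

record ℝ : Set where
  constructor mkℝ
  field
    seq    : ℕ → ℚ
    cauchy : IsCauchy seq

open ℝ public

infix  4 _<ℝ_ _≤ℝ_ _≤∞_
infixl 6 _+ℝ_ _-ℝ_ _+∞_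
infixl 7 _·ℝ_ _⊓ℝ_ _⊓∞_

fromℚ : ℚ → ℝ
fromℚ q = mkℝ (const q) λ ε 0<ε → 0 , λ _ _ _ _ →
  subst (ℚ._≤ q ℚ.+ ε) (ℚₚ.+-identityʳ q) (ℚₚ.+-monoʳ-≤ q (ℚₚ.<⇒≤ 0<ε))

0ℝ 1ℝ ½ℝ : ℝ
0ℝ = fromℚ 0ℚ
1ℝ = fromℚ 1ℚ
½ℝ = fromℚ ½

private
  halve : ∀ {ε} → 0ℚ ℚ.< ε → 0ℚ ℚ.< ½ ℚ.* ε
  halve {ε} 0<ε =
    subst (ℚ._< ½ ℚ.* ε) (ℚₚ.*-zeroʳ ½) (ℚₚ.*-monoʳ-<-pos ½ 0<ε)

  regroup : ∀ a b ε →
    (a ℚ.+ ½ ℚ.* ε) ℚ.+ (b ℚ.+ ½ ℚ.* ε) ≡ (a ℚ.+ b) ℚ.+ ε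
  regroup a b ε = trans (interchange a (½ ℚ.* ε) b (½ ℚ.* ε))
    (cong ((a ℚ.+ b) ℚ.+_)
      (trans (sym (ℚₚ.*-distribʳ-+ ε ½ ½)) (ℚₚ.*-identityˡ ε)))

  flip-neg : ∀ {a b} ε → a ℚ.≤ b ℚ.+ ε → ℚ.- b ℚ.≤ ℚ.- a ℚ.+ ε
  flip-neg {a} {b} ε a≤b+ε = subst (ℚ._≤ ℚ.- a ℚ.+ ε) cancel
    (ℚₚ.+-monoˡ-≤ ε (ℚₚ.neg-antimono-≤ a≤b+ε))
    where
    cancel : ℚ.- (b ℚ.+ ε) ℚ.+ ε ≡ ℚ.- b
    cancel = trans (cong (ℚ._+ ε) (ℚₚ.neg-distrib-+ b ε))
      (trans (ℚₚ.+-assoc (ℚ.- b) (ℚ.- ε) ε)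
        (trans (cong (ℚ.- b ℚ.+_) (ℚₚ.+-inverseˡ ε)) (ℚₚ.+-identityʳ (ℚ.- b))))

_+ℝ_ : ℝ → ℝ → ℝ
mkℝ x cx +ℝ mkℝ y cy = mkℝ (λ k → x k ℚ.+ y k) c
  where
  c : IsCauchy (λ k → x k ℚ.+ y k)
  c ε 0<ε with cx (½ ℚ.* ε) (halve 0<ε) | cy (½ ℚ.* ε) (halve 0<ε)
  ... | M , hx | N , hy = M ℕ.⊔ N , λ m n p q →
    subst (x m ℚ.+ y m ℚ.≤_) (regroup (x n) (y n) ε)
      (ℚₚ.+-mono-≤
        (hx m n (ℕₚ.m⊔n≤o⇒m≤o M N p) (ℕₚ.m⊔n≤o⇒m≤o M N q))
        (hy m n (ℕₚ.m⊔n≤o⇒n≤o M N p) (ℕₚ.m⊔n≤o⇒n≤o M N q)))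

-ℝ_ : ℝ → ℝ
-ℝ mkℝ x cx = mkℝ (λ k → ℚ.- x k) c
  where
  c : IsCauchy (λ k → ℚ.- x k)
  c ε 0<ε with cx ε 0<ε
  ... | N , h = N , λ m n p q → flip-neg ε (h n m q p)

_-ℝ_ : ℝ → ℝ → ℝ
x -ℝ y = x +ℝ (-ℝ y)

_⊓ℝ_ : ℝ → ℝ → ℝ
mkℝ x cx ⊓ℝ mkℝ y cy = mkℝ (λ k → x k ℚ.⊓ y k) c
  where
  c : IsCauchy (λ k → x k ℚ.⊓ y k)
  c ε 0<ε with cx ε 0<ε | cy ε 0<ε
  ... | M , hx | N , hy = M ℕ.⊔ N , λ m n p q →
    subst (x m ℚ.⊓ y m ℚ.≤_)
      (sym (ℚₚ.mono-≤-distrib-⊓ (ℚₚ.+-monoˡ-≤ ε) (x n) (y n)))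
      (ℚₚ.⊓-mono-≤
        (hx m n (ℕₚ.m⊔n≤o⇒m≤o M N p) (ℕₚ.m⊔n≤o⇒m≤o M N q))
        (hy m n (ℕₚ.m⊔n≤o⇒n≤o M N p) (ℕₚ.m⊔n≤o⇒n≤o M N q)))

_·ℝ_ : ℕ → ℝ → ℝ
zero  ·ℝ x = 0ℝ
suc n ·ℝ x = x +ℝ n ·ℝ x

_<ℝ_ : ℝ → ℝ → Set
x <ℝ y = ∃[ ε ] 0ℚ ℚ.< ε × ∃[ N ] ∀ n → N ℕ.≤ n → seq x n ℚ.+ ε ℚ.≤ seq y n

_≤ℝ_ : ℝ → ℝ → Set
x ≤ℝ y = ¬ (y <ℝ x)

-- The reals extended by ∞ = nothing.
ℝ∞ : Set
ℝ∞ = Maybe ℝ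

_+∞_ : ℝ∞ → ℝ∞ → ℝ∞
just x +∞ just y = just (x +ℝ y)
_      +∞ _      = nothing

_⊓∞_ : ℝ∞ → ℝ∞ → ℝ∞
just x  ⊓∞ just y  = just (x ⊓ℝ y)
just x  ⊓∞ nothing = just x
nothing ⊓∞ y       = y

_≤∞_ : ℝ∞ → ℝ∞ → Set
_       ≤∞ nothing = ⊤
nothing ≤∞ just _  = ⊥
just x  ≤∞ just y  = x ≤ℝ y

------------------------------------------------------------------------
-- Road networks

-- {u , v} is an edge exactly when weight u v is not nothing.
record RoadNetwork : Set where
  field
    order     : ℕ
  V : Set
  V = Fin order
  field
    weight    : V → V → Maybe ℝ
    symmetric : ∀ u v → weight u v ≡ weight v u
    positive  : ∀ u v {r} → weight u v ≡ just r → 0ℝ <ℝ r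

  Edge : V → V → Set
  Edge u v = Is-just (weight u v)

  edge? : Decidable Edge
  edge? u v with weight u v
  ... | just _  = yes (just tt)
  ... | nothing = no λ ()

  vertices : List V
  vertices = allFin order

  -- Paths are given by their vertex sequence; a path from v to v may consist
  -- of v alone.
  IsPath : V → V → List V → Set
  IsPath s t p = head p ≡ just s × last p ≡ just t × Unique p × Linked Edge p

  isPath? : ∀ s t p → Dec (IsPath s t p)
  isPath? s t p =
    ≡-dec _≟F_ (head p) (just s) ×-dec
    ≡-dec _≟F_ (last p) (just t) ×-dec
    UniqueDec.unique? _≟F_ p     ×-dec
    linked? edge? p

  pathWeight : List V → ℝ∞
  pathWeight (u ∷ v ∷ p) = weight u v +∞ pathWeight (v ∷ p)
  pathWeight _           = just 0ℝ

  IsShortestPath : V → V → List V → Set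
  IsShortestPath s t p =
    IsPath s t p × (∀ q → IsPath s t q → pathWeight p ≤∞ pathWeight q)

  Connected : V → V → Set
  Connected s t = ∃[ p ] IsPath s t p

  sequences : ℕ → List (List V)
  sequences zero    = [] ∷ []
  sequences (suc k) = cartesianProductWith _∷_ vertices (sequences k)

  -- All paths from s to t: a path has no repeated vertex, hence at most
  -- order many vertices.
  paths : V → V → List (List V)
  paths s t = filter (isPath? s t) (concatMap sequences (upTo (suc order)))

  -- The distance is ∞ when t cannot be reached from s.
  d : V → V → ℝ∞
  d s t = foldr _⊓∞_ nothing (map pathWeight (paths s t))

------------------------------------------------------------------------
-- Rooted binary trees

-- A child may be missing (empty) independently of its sibling.
data BinaryTree : Set where
  empty : BinaryTree
  node  : (left right : BinaryTree) → BinaryTree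

data Node : BinaryTree → Set where
  root : ∀ {l r} → Node (node l r)
  inˡ  : ∀ {l r} → Node l → Node (node l r)
  inʳ  : ∀ {l r} → Node r → Node (node l r)

nodes : ∀ t → List (Node t)
nodes empty      = []
nodes (node l r) = root ∷ map inˡ (nodes l) ++ map inʳ (nodes r)

infix 4 _≟N_ _≼_ _≼?_

_≟N_ : ∀ {t} → DecidableEquality (Node t)
root  ≟N root  = yes refl
root  ≟N inˡ _ = no λ ()
root  ≟N inʳ _ = no λ ()
inˡ _ ≟N root  = no λ ()
inˡ x ≟N inˡ y = map′ (cong inˡ) (λ { refl → refl }) (x ≟N y)
inˡ _ ≟N inʳ _ = no λ ()
inʳ _ ≟N root  = no λ ()
inʳ _ ≟N inˡ _ = no λ ()
inʳ x ≟N inʳ y = map′ (cong inʳ) (λ { refl → refl }) (x ≟N y)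

-- M ≼ N : M is an ancestor of N, possibly N itself; equivalently, N lies in
-- the subtree rooted at M.
data _≼_ : ∀ {t} → Node t → Node t → Set where
  root : ∀ {l r} {N : Node (node l r)} → root ≼ N
  inˡ  : ∀ {l r} {M N : Node l} → M ≼ N → inˡ {l} {r} M ≼ inˡ N
  inʳ  : ∀ {l r} {M N : Node r} → M ≼ N → inʳ {l} {r} M ≼ inʳ N

_≼?_ : ∀ {t} (M N : Node t) → Dec (M ≼ N)
root  ≼? _     = yes root
inˡ _ ≼? root  = no λ ()
inˡ M ≼? inˡ N = map′ inˡ (λ { (inˡ p) → p }) (M ≼? N)
inˡ _ ≼? inʳ _ = no λ ()
inʳ _ ≼? root  = no λ ()
inʳ _ ≼? inˡ _ = no λ ()
inʳ M ≼? inʳ N = map′ inʳ (λ { (inʳ p) → p }) (M ≼? N)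

-- InLeft M N : N lies in the subtree rooted at the left child of M.
data InLeft : ∀ {t} → Node t → Node t → Set where
  root : ∀ {l r} {N : Node l} → InLeft (root {l} {r}) (inˡ N)
  inˡ  : ∀ {l r} {M N : Node l} → InLeft M N → InLeft (inˡ {l} {r} M) (inˡ N)
  inʳ  : ∀ {l r} {M N : Node r} → InLeft M N → InLeft (inʳ {l} {r} M) (inʳ N)

data InRight : ∀ {t} → Node t → Node t → Set where
  root : ∀ {l r} {N : Node r} → InRight (root {l} {r}) (inʳ N)
  inˡ  : ∀ {l r} {M N : Node l} → InRight M N → InRight (inˡ {l} {r} M) (inˡ N)
  inʳ  : ∀ {l r} {M N : Node r} → InRight M N → InRight (inʳ {l} {r} M) (inʳ N)

inLeft? : ∀ {t} (M N : Node t) → Dec (InLeft M N)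
inLeft? root    root    = no λ ()
inLeft? root    (inˡ _) = yes root
inLeft? root    (inʳ _) = no λ ()
inLeft? (inˡ _) root    = no λ ()
inLeft? (inˡ M) (inˡ N) = map′ inˡ (λ { (inˡ p) → p }) (inLeft? M N)
inLeft? (inˡ _) (inʳ _) = no λ ()
inLeft? (inʳ _) root    = no λ ()
inLeft? (inʳ _) (inˡ _) = no λ ()
inLeft? (inʳ M) (inʳ N) = map′ inʳ (λ { (inʳ p) → p }) (inLeft? M N)

inRight? : ∀ {t} (M N : Node t) → Dec (InRight M N)
inRight? root    root    = no λ ()
inRight? root    (inˡ _) = no λ ()
inRight? root    (inʳ _) = yes root
inRight? (inˡ _) root    = no λ ()
inRight? (inˡ M) (inˡ N) = map′ inˡ (λ { (inˡ p) → p }) (inRight? M N)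
inRight? (inˡ _) (inʳ _) = no λ ()
inRight? (inʳ _) root    = no λ ()
inRight? (inʳ _) (inˡ _) = no λ ()
inRight? (inʳ M) (inʳ N) = map′ inʳ (λ { (inʳ p) → p }) (inRight? M N)

IsInternal : ∀ {t} → Node t → Set
IsInternal M = ∃[ N ] M ≼ N × ¬ M ≡ N

IsLowestCommonAncestor : ∀ {t} (N M₁ M₂ : Node t) → Set
IsLowestCommonAncestor N M₁ M₂ =
  N ≼ M₁ × N ≼ M₂ × (∀ N′ → N′ ≼ M₁ → N′ ≼ M₂ → N′ ≼ N)

------------------------------------------------------------------------
-- Tree hierarchies. A set of vertices is the duplicate-free list of its
-- members, so that length is cardinality.

module VertexSets (G : RoadNetwork) {t : BinaryTree}
                  (ℓ : RoadNetwork.V G → Node t) where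
  open RoadNetwork G

  Contents Subtree Left Right : Node t → List V
  Contents N = filter (λ v → ℓ v ≟N N) vertices
  Subtree  N = filter (λ v → N ≼? ℓ v) vertices
  Left     N = filter (λ v → inLeft? N (ℓ v)) vertices
  Right    N = filter (λ v → inRight? N (ℓ v)) vertices

  infix 4 _⪯_ _⪯?_

  _⪯_ : V → V → Set
  u ⪯ v = ℓ u ≼ ℓ v

  _⪯?_ : Decidable _⪯_
  u ⪯? v = ℓ u ≼? ℓ v

  A : V → List V
  A v = filter (_⪯? v) vertices

record BalancedTreeHierarchy (G : RoadNetwork) (β : ℝ) : Set where
  open RoadNetwork G
  field
    left right : BinaryTree

  -- A rooted tree has a root, so it is not empty.
  tree : BinaryTree
  tree = node left right

  field
    ℓ          : V → Node tree
    surjective : Surjective _≡_ _≡_ ℓ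

  open VertexSets G ℓ public

  field
    balancedˡ : ∀ N → IsInternal N →
      length (Left N) ·ℝ 1ℝ ≤ℝ length (Subtree N) ·ℝ (1ℝ -ℝ β)
    balancedʳ : ∀ N → IsInternal N →
      length (Right N) ·ℝ 1ℝ ≤ℝ length (Subtree N) ·ℝ (1ℝ -ℝ β)
    -- Only pairs joined by some path have shortest paths.
    separates : ∀ s t N → IsLowestCommonAncestor N (ℓ s) (ℓ t) →
      Connected s t →
      ∃[ p ] IsShortestPath s t p × ∃[ v ] v ∈ p × ℓ v ≡ N

------------------------------------------------------------------------
-- The naive labelling

module _ {G : RoadNetwork} {β : ℝ} (H : BalancedTreeHierarchy G β) where
  open RoadNetwork G
  open BalancedTreeHierarchy H

  DistanceEntry : Set
  DistanceEntry = V × ℝ∞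

  Labelling : Set
  Labelling = V → List DistanceEntry

  addEntry : V → V → Labelling → Labelling
  addEntry u v L = Vector.updateAt L v ((u , d u v) ∷_)

  for_∶_ : ∀ {X : Set} → List X → (X → Labelling → Labelling) →
           Labelling → Labelling
  (for xs ∶ body) L = foldr body L xs

  naiveLabelling : Labelling
  naiveLabelling =
    (for nodes tree ∶ λ N →
      for Contents N ∶ λ u →
        for Subtree N ∶ λ v →
          addEntry u v)
    (const [])

  space : Labelling → ℕ
  space L = sum (map (λ v → length (L v)) vertices)

{-# OPTIONS --safe #-}
-- Each stored entry is a triple (N , u , v) with ℓ u = N and N ≼ ℓ v. The node N
-- is determined by u, so the triples are the pairs u ⪯ v, and these are counted
-- either by u or by v. The constant is 1.
module Submission where

open import Data.Bool.Base using (true; false; if_then_else_)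
open import Data.Fin.Base using (Fin; zero; suc)
open import Data.List.Base using (List; []; _∷_; filter; foldr; length; map; tabulate)
open import Data.List.Membership.Propositional.Properties using (∈-map⁻)
open import Data.List.Properties using (map-cong; map-tabulate)
open import Data.List.Relation.Unary.All using (All; []; _∷_; universal)
import Data.List.Relation.Unary.All.Properties as All
open import Data.List.Relation.Binary.Disjoint.Propositional using (Disjoint)
open import Data.List.Relation.Unary.Unique.Propositional using (Unique; []; _∷_)
import Data.List.Relation.Unary.Unique.Propositional.Properties as Unique
open import Data.Nat.Base using (ℕ; suc; _+_; _≤_; z≤n; _*_)
open import Data.Nat.ListAction using (sum)
open import Data.Nat.Properties
  using (+-mono-≤; +-identityʳ; +-suc; +-assoc; *-identityˡ; ≤-trans; ≤-reflexive;
         +-commutativeSemigroup; module ≤-Reasoning)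
open import Data.Product.Base using (∃-syntax; _,_)
open import Data.Vec.Functional using (updateAt)
open import Function.Base using (_∘_; const; id)
open import Relation.Binary.Definitions using (DecidableEquality)
open import Relation.Binary.PropositionalEquality
  using (_≡_; _≢_; refl; sym; trans; cong; module ≡-Reasoning)
open import Relation.Nullary using (Dec; does; yes; no; contradiction)
open import Relation.Unary using (Decidable)
open import Algebra.Properties.CommutativeSemigroup +-commutativeSemigroup using (interchange)
open import Defs

private variable
  X Y : Set

∑ : List X → (X → ℕ) → ℕ
∑ xs f = sum (map f xs)

∑-cong : ∀ {f g : X → ℕ} (xs : List X) → (∀ x → f x ≡ g x) → ∑ xs f ≡ ∑ xs g
∑-cong xs f≗g = cong sum (map-cong f≗g xs)

∑-mono-≤ : ∀ {f g : X → ℕ} (xs : List X) → (∀ x → f x ≤ g x) → ∑ xs f ≤ ∑ xs g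
∑-mono-≤ []       f≤g = z≤n
∑-mono-≤ (x ∷ xs) f≤g = +-mono-≤ (f≤g x) (∑-mono-≤ xs f≤g)

∑-zero : ∀ (xs : List X) → ∑ xs (const 0) ≡ 0
∑-zero []       = refl
∑-zero (_ ∷ xs) = ∑-zero xs

∑-one : ∀ (xs : List X) → ∑ xs (const 1) ≡ length xs
∑-one []       = refl
∑-one (_ ∷ xs) = cong suc (∑-one xs)

∑-+ : ∀ (f g : X → ℕ) (xs : List X) → ∑ xs (λ x → f x + g x) ≡ ∑ xs f + ∑ xs g
∑-+ f g []       = refl
∑-+ f g (x ∷ xs) =
  trans (cong (f x + g x +_) (∑-+ f g xs)) (interchange (f x) (g x) (∑ xs f) (∑ xs g))

∑-swap : ∀ (f : X → Y → ℕ) (xs : List X) (ys : List Y) →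
  ∑ xs (λ x → ∑ ys (f x)) ≡ ∑ ys (λ y → ∑ xs (λ x → f x y))
∑-swap f []       ys = sym (∑-zero ys)
∑-swap f (x ∷ xs) ys =
  trans (cong (∑ ys (f x) +_) (∑-swap f xs ys))
        (sym (∑-+ (f x) (λ y → ∑ xs (λ x → f x y)) ys))

infix 9 [_]_

-- The Iverson bracket of `P`, as a factor in front of `n`.
[_]_ : ∀ {P : Set} → Dec P → ℕ → ℕ
[ P? ] n = if does P? then n else 0

-- Moves a condition from the range into the summand. A range that depends on an outer variable
-- becomes a fixed list, as `∑-swap` requires.
∑-filter : ∀ {P : X → Set} (P? : Decidable P) (f : X → ℕ) (xs : List X) →
  ∑ (filter P? xs) f ≡ ∑ xs (λ x → [ P? x ] f x)
∑-filter P? f []       = refl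
∑-filter P? f (x ∷ xs) with does (P? x)
... | true  = cong (f x +_) (∑-filter P? f xs)
... | false = ∑-filter P? f xs

module _ (_≟_ : DecidableEquality X) (f : X → ℕ) where

  ∑-point-absent : ∀ {y xs} → All (y ≢_) xs → ∑ xs (λ x → [ y ≟ x ] f x) ≡ 0
  ∑-point-absent []                           = refl
  ∑-point-absent {y} {x ∷ _} (y≢x ∷ y∉xs) with y ≟ x
  ... | yes y≡x = contradiction y≡x y≢x
  ... | no  _   = ∑-point-absent y∉xs

  -- Without repetitions at most one summand survives. Equality would also need `y` to occur in
  -- `xs`; an upper bound does not.
  ∑-point-≤ : ∀ y {xs} → Unique xs → ∑ xs (λ x → [ y ≟ x ] f x) ≤ f y
  ∑-point-≤ y []                          = z≤n
  ∑-point-≤ y {x ∷ _} (x∉xs ∷ xs!) with y ≟ x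
  ... | yes refl = ≤-reflexive (trans (cong (f y +_) (∑-point-absent x∉xs)) (+-identityʳ (f y)))
  ... | no  _    = ∑-point-≤ y xs!

-- Cost of a loop: the increment `f x` is independent of the state `y`, so increments add up. The
-- conclusion for a loop has the shape of the hypothesis on `step`, so nested loops are handled by
-- nesting the lemma.
foldr-measure : ∀ (μ : Y → ℕ) (step : X → Y → Y) (f : X → ℕ) →
  (∀ x y → μ (step x y) ≡ f x + μ y) →
  ∀ xs y → μ (foldr step y xs) ≡ ∑ xs f + μ y
foldr-measure μ step f μ-step []       y = refl
foldr-measure μ step f μ-step (x ∷ xs) y =
  trans (μ-step x _)
    (trans (cong (f x +_) (foldr-measure μ step f μ-step xs y))
           (sym (+-assoc (f x) (∑ xs f) (μ y))))

-- Stated with `tabulate` because it splits off index `zero` by computation, leaving the same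
-- problem for `L ∘ suc`.
sum-tabulate-updateAt : ∀ {n} (L : Fin n → List X) v (e : X) →
  sum (tabulate (length ∘ updateAt L v (e ∷_))) ≡ suc (sum (tabulate (length ∘ L)))
sum-tabulate-updateAt L zero    e = refl
sum-tabulate-updateAt L (suc v) e =
  trans (cong (length (L zero) +_) (sum-tabulate-updateAt (L ∘ suc) v e))
        (+-suc (length (L zero)) _)

-- Different constructors separate the root and the two subtrees; injectivity of `inˡ` and `inʳ`
-- handles each subtree.
nodes-unique : ∀ t → Unique (nodes t)
nodes-unique empty      = []
nodes-unique (node l r) =
  All.++⁺ (All.map⁺ (universal (λ _ ()) (nodes l)))
          (All.map⁺ (universal (λ _ ()) (nodes r)))
  ∷ Unique.++⁺ (Unique.map⁺ (λ { refl → refl }) (nodes-unique l))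
               (Unique.map⁺ (λ { refl → refl }) (nodes-unique r))
               disjoint
  where
  disjoint : Disjoint (map inˡ (nodes l)) (map inʳ (nodes r))
  disjoint (N∈l , N∈r) with ∈-map⁻ inˡ N∈l | ∈-map⁻ inʳ N∈r
  ... | _ , _ , refl | _ , _ , ()

module _ {G : RoadNetwork} {β : ℝ} (H : BalancedTreeHierarchy G β) where
  open RoadNetwork G
  open BalancedTreeHierarchy H

  space-addEntry : ∀ u v L → space H (addEntry H u v L) ≡ 1 + space H L
  space-addEntry u v L =
    -- `vertices` is `tabulate id`, so `space` can be rewritten as a sum over `tabulate` and back.
    trans (cong sum (map-tabulate id (length ∘ addEntry H u v L)))
      (trans (sum-tabulate-updateAt L v (u , d u v))
        (cong (suc ∘ sum) (sym (map-tabulate id (length ∘ L)))))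

  space-naiveLabelling : space H (naiveLabelling H) ≡
    ∑ (nodes tree) λ N → ∑ (Contents N) λ u → ∑ (Subtree N) λ v → 1
  space-naiveLabelling = begin
    space H (naiveLabelling H)
      -- One application for each of the three loops, over `N`, `u` and `v`; the innermost body
      -- costs 1.
      ≡⟨ foldr-measure (space H) processNode entries
           (λ N → foldr-measure (space H) (addEntries N) (λ _ → ∑ (Subtree N) λ v → 1)
             (λ u → foldr-measure (space H) (addEntry H u) (const 1)
               (space-addEntry u) (Subtree N))
             (Contents N))
           (nodes tree) (const []) ⟩
    ∑ (nodes tree) entries + space H (const [])
      ≡⟨ cong (∑ (nodes tree) entries +_) (∑-zero vertices) ⟩
    ∑ (nodes tree) entries + 0
      ≡⟨ +-identityʳ (∑ (nodes tree) entries) ⟩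
    ∑ (nodes tree) entries ∎
    where
    open ≡-Reasoning
    addEntries : Node tree → V → Labelling H → Labelling H
    addEntries N u = (for H ∶ Subtree N) (addEntry H u)

    processNode : Node tree → Labelling H → Labelling H
    processNode N = (for H ∶ Contents N) (addEntries N)

    entries : Node tree → ℕ
    entries N = ∑ (Contents N) λ u → ∑ (Subtree N) λ v → 1

  space-naiveLabelling-≤ : space H (naiveLabelling H) ≤ ∑ vertices (length ∘ A)
  space-naiveLabelling-≤ = begin
    space H (naiveLabelling H)
      ≡⟨ space-naiveLabelling ⟩
    (∑ (nodes tree) λ N → ∑ (Contents N) λ u → ∑ (Subtree N) λ v → 1)
      ≡⟨ ∑-cong (nodes tree) (λ N → ∑-filter (λ u → ℓ u ≟N N) _ vertices) ⟩
    (∑ (nodes tree) λ N → ∑ vertices λ u → [ ℓ u ≟N N ] ∑ (Subtree N) λ v → 1)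
      ≡⟨ ∑-swap _ (nodes tree) vertices ⟩
    (∑ vertices λ u → ∑ (nodes tree) λ N → [ ℓ u ≟N N ] ∑ (Subtree N) λ v → 1)
      -- Only the node `N = ℓ u` contributes for a given `u`.
      ≤⟨ ∑-mono-≤ vertices (λ u → ∑-point-≤ _≟N_ _ (ℓ u) (nodes-unique tree)) ⟩
    (∑ vertices λ u → ∑ (Subtree (ℓ u)) λ v → 1)
      -- By definition `Subtree (ℓ u)` filters by `ℓ u ≼? ℓ v`, which is `u ⪯? v`.
      ≡⟨ ∑-cong vertices (λ u → ∑-filter (u ⪯?_) _ vertices) ⟩
    (∑ vertices λ u → ∑ vertices λ v → [ u ⪯? v ] 1)
      ≡⟨ ∑-swap (λ u v → [ u ⪯? v ] 1) vertices vertices ⟩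
    (∑ vertices λ v → ∑ vertices λ u → [ u ⪯? v ] 1)
      ≡⟨ ∑-cong vertices (λ v → ∑-filter (_⪯? v) _ vertices) ⟨
    (∑ vertices λ v → ∑ (A v) λ u → 1)
      ≡⟨ ∑-cong vertices (λ v → ∑-one (A v)) ⟩
    ∑ vertices (length ∘ A) ∎
    where open ≤-Reasoning

lemma4p15 : ∃[ C ] ∀ (G : RoadNetwork) (β : ℝ) → 0ℝ <ℝ β → β ≤ℝ ½ℝ →
    (H : BalancedTreeHierarchy G β) →
    space H (naiveLabelling H)
    ≤ C * sum (map (λ v → length (BalancedTreeHierarchy.A H v)) (RoadNetwork.vertices G))
lemma4p15 = 1 , λ G β _ _ H →
  ≤-trans (space-naiveLabelling-≤ H) (≤-reflexive (sym (*-identityˡ _)))
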